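{- For the online AdCell problem with capacity constraints only, no online algorithm can achieve in expectation a ratio better than $\frac12$ of the revenue of the optimal offline allocation without further assumptions: for every $\delta>0$ there is an instance for which every online algorithm has expected revenue at most $\left(\frac12+\delta\right)$ times the expected revenue of the optimal offline allocation, the latter being positive.
   Context: Problem. There are advertisers $i\in[m]$, queries $j\in[n]$, customers $k\in[s]$, and bids $u_{ij}\ge0$ of advertiser $i$ for query $j$. The queries are partitioned into sets $S_1,\dots,S_s$, where $S_k$ is the set of queries of customer $k$; customer $k$ has an integer capacity $c_k$. Each query $j$ has an arrival time and arrives with probability $p_j$; $I_j\in\{0,1\}$ is its arrival indicator. Arrivals of queries with different arrival times or from different customers are independent; queries of the same customer with the same arrival time are mutually exclusive (at most one of them arrives). All parameters ($p_j,u_{ij},c_k$, arrival times) are known in advance, but the actual value of $I_j$ is learned only at the arrival time of query $j$. In an online algorithm (possibly randomized) each query, upon arrival, must immediately and irrevocably be allocated to one advertiser or discarded. An allocation is $X_{ij}\in\{0,1\}$ with $\sum_i X_{ij}\le I_j$ for all $j$ and $\sum_{j\in S_k}\sum_i X_{ij}\le c_k$ for all $k$; there are no budget constraints, and its revenue is $\sum_i\sum_j X_{ij}u_{ij}$. The optimal offline allocation is an allocation maximizing the revenue with full knowledge of the realized $I_1,\dots,I_n$. -}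

module Defs where

open import Algebra.Bundles using (CommutativeRing)
import Algebra.Properties.Monoid.Sum as MonoidSum
open import Data.Bool using (Bool; true; false; if_then_else_)
import Data.Bool.Properties as Bool
open import Data.Fin using (Fin)
import Data.Fin.Properties as Fin
open import Data.Fin.Subset using (Subset; inside; outside; _∈_)
open import Data.Fin.Subset.Properties using (_∈?_)
open import Data.Nat using (ℕ; zero; suc)
import Data.Nat as ℕ
import Data.Nat.Properties as ℕ
open import Data.Product using (_×_; _,_)
open import Data.Sum using (inj₁; inj₂)
open import Data.Vec using ([]; _∷_; lookup)
open import Level using (Level; 0ℓ) renaming (suc to lsuc; _⊔_ to _⊔ˡ_)
open import Relation.Binary using (Rel; IsTotalOrder)
open import Relation.Binary.PropositionalEquality using (_≡_; _≢_)
open import Relation.Nullary using (¬_; Dec; does; _×-dec_; _→-dec_; ¬?)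
open import Relation.Unary using (Pred; Decidable)

-- Stands in for ℝ, which the standard library lacks: results are stated for an
-- arbitrary ordered field, so they cover ℝ and need no completeness.
record OrderedField (c ℓ₁ ℓ₂ : Level) : Set (lsuc (c ⊔ˡ ℓ₁ ⊔ˡ ℓ₂)) where
  infix 4 _≤_ _<_
  field
    commutativeRing : CommutativeRing c ℓ₁
  open CommutativeRing commutativeRing public
  field
    _≤_          : Rel Carrier ℓ₂
    isTotalOrder : IsTotalOrder _≈_ _≤_
    +-monoʳ-≤    : ∀ z {x y} → x ≤ y → z + x ≤ z + y
    *-nonneg     : ∀ {x y} → 0# ≤ x → 0# ≤ y → 0# ≤ x * y
    0≉1          : ¬ (0# ≈ 1#)
    inv          : ∀ x → ¬ (x ≈ 0#) → Carrier
    inv-inverse  : ∀ x (x≉0 : ¬ (x ≈ 0#)) → x * inv x x≉0 ≈ 1#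

  _<_ : Rel Carrier (ℓ₁ ⊔ˡ ℓ₂)
  x < y = x ≤ y × ¬ (x ≈ y)

  private
    module O = IsTotalOrder isTotalOrder
    open import Algebra.Properties.Ring ring using (-1*x≈-x; -‿involutive)

    0≤1 : 0# ≤ 1#
    0≤1 with O.total 0# 1#
    ... | inj₁ p = p
    ... | inj₂ 1≤0 = O.≤-respʳ-≈ (trans (-1*x≈-x (- 1#)) (-‿involutive 1#))
                                 (*-nonneg 0≤-1 0≤-1)
      where
        0≤-1 : 0# ≤ - 1#
        0≤-1 = O.≤-respˡ-≈ (-‿inverseˡ 1#)
                 (O.≤-respʳ-≈ (+-identityʳ (- 1#)) (+-monoʳ-≤ (- 1#) 1≤0))

  2≉0 : ¬ (1# + 1# ≈ 0#)
  2≉0 2≈0 = 0≉1 (O.antisym 0≤1 (O.≤-respʳ-≈ 2≈0 1≤2))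
    where
      1≤2 : 1# ≤ 1# + 1#
      1≤2 = O.≤-respˡ-≈ (+-identityʳ 1#) (+-monoʳ-≤ 1# 0≤1)

  ½ : Carrier
  ½ = inv (1# + 1#) 2≉0

module AdCell {c ℓ₁ ℓ₂ : Level} (F : OrderedField c ℓ₁ ℓ₂) where
  open OrderedField F
  open MonoidSum +-monoid public using () renaming (sum to sumF)
  open MonoidSum ℕ.+-0-monoid public using () renaming (sum to sumℕ)

  -- The realised I₁,…,Iₙ, as the set of queries that arrive.
  Outcome : ℕ → Set
  Outcome n = Subset n

  sumOutcomes : ∀ {n} → (Outcome n → Carrier) → Carrier
  sumOutcomes {zero}  f = f []
  sumOutcomes {suc n} f =
    sumOutcomes (λ ω → f (inside ∷ ω)) + sumOutcomes (λ ω → f (outside ∷ ω))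

  AgreeOn : ∀ {n} → Pred (Fin n) 0ℓ → Rel (Outcome n) 0ℓ
  AgreeOn B ω ω′ = ∀ j → B j → lookup ω j ≡ lookup ω′ j

  agreeOn? : ∀ {n} {B : Pred (Fin n) 0ℓ} → Decidable B →
             (ω : Outcome n) → Decidable (AgreeOn B ω)
  agreeOn? B? ω ω′ = Fin.all? (λ j → B? j →-dec (lookup ω j Bool.≟ lookup ω′ j))

  record Instance : Set (c ⊔ˡ ℓ₁ ⊔ˡ ℓ₂) where
    field
      m n s    : ℕ
      u        : Fin m → Fin n → Carrier
      u-nonneg : ∀ i j → 0# ≤ u i j
      -- S_k is the fibre of customer over k.
      customer : Fin n → Fin s
      capacity : Fin s → ℕ
      -- Only the order of, and coincidences between, arrival times matter.
      time     : Fin n → ℕ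
      p        : Fin n → Carrier
      -- Joint law of I₁,…,Iₙ; the conditions below determine it from p,
      -- customer and time.
      law        : Outcome n → Carrier
      law-nonneg : ∀ ω → 0# ≤ law ω
      law-total  : sumOutcomes law ≈ 1#

    SameSlot : Rel (Fin n) 0ℓ
    SameSlot j j′ = customer j ≡ customer j′ × time j ≡ time j′

    sameSlot? : ∀ j → Decidable (SameSlot j)
    sameSlot? j j′ = (customer j Fin.≟ customer j′) ×-dec (time j ℕ.≟ time j′)

    Pr : {E : Pred (Outcome n) 0ℓ} → Decidable E → Carrier
    Pr E? = sumOutcomes (λ ω → if does (E? ω) then law ω else 0#)

    field
      marginal  : ∀ j → Pr (j ∈?_) ≈ p j
      exclusive : ∀ {j j′} → j ≢ j′ → SameSlot j j′ →
                  ∀ ω → j ∈ ω → j′ ∈ ω → law ω ≈ 0#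
      -- Each block of queries sharing customer and time is independent of all
      -- other queries jointly; as this holds for every block, the blocks are
      -- mutually independent.
      independent : ∀ j ω →
        law ω ≈ Pr (agreeOn? (sameSlot? j) ω)
                * Pr (agreeOn? (λ j′ → ¬? (sameSlot? j j′)) ω)

    𝔼 : (Outcome n → Carrier) → Carrier
    𝔼 f = sumOutcomes (λ ω → law ω * f ω)

  module _ (I : Instance) where
    open Instance I

    Allocation : Set
    Allocation = Fin m → Fin n → Bool

    bit : Bool → ℕ
    bit b = if b then 1 else 0

    record Feasible (ω : Outcome n) (X : Allocation) : Set where
      field
        arrived : ∀ j → sumℕ (λ i → bit (X i j)) ℕ.≤ bit (lookup ω j)
        within  : ∀ k →
          sumℕ (λ j → if does (customer j Fin.≟ k)
                      then sumℕ (λ i → bit (X i j)) else 0)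
          ℕ.≤ capacity k

    revenue : Allocation → Carrier
    revenue X = sumF (λ i → sumF (λ j → if X i j then u i j else 0#))

    record OptimalOffline : Set (c ⊔ˡ ℓ₁ ⊔ˡ ℓ₂) where
      field
        alloc    : Outcome n → Allocation
        feasible : ∀ ω → Feasible ω (alloc ω)
        optimal  : ∀ ω X → Feasible ω X → revenue X ≤ revenue (alloc ω)

    -- The decision on query j may depend on every arrival up to and including
    -- time j.
    record DeterministicOnline : Set where
      field
        alloc           : Outcome n → Allocation
        feasible        : ∀ ω → Feasible ω (alloc ω)
        nonanticipating : ∀ j ω ω′ →
          AgreeOn (λ j′ → time j′ ℕ.≤ time j) ω ω′ →
          ∀ i → alloc ω i j ≡ alloc ω′ i j

    -- A randomized algorithm draws a deterministic one, independently of the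
    -- arrivals. An instance has only finitely many deterministic algorithms up
    -- to pointwise equality, so finite distributions lose no generality.
    record OnlineAlgorithm : Set (c ⊔ˡ ℓ₁ ⊔ˡ ℓ₂) where
      field
        seeds         : ℕ
        weight        : Fin seeds → Carrier
        weight-nonneg : ∀ r → 0# ≤ weight r
        weight-total  : sumF weight ≈ 1#
        run           : Fin seeds → DeterministicOnline

    offlineRevenue : OptimalOffline → Carrier
    offlineRevenue O = 𝔼 (λ ω → revenue (OptimalOffline.alloc O ω))

    onlineRevenue : OnlineAlgorithm → Carrier
    onlineRevenue A =
      sumF (λ r → weight r * 𝔼 (λ ω → revenue (DeterministicOnline.alloc (run r) ω)))
      where open OnlineAlgorithm A

{-# OPTIONS --safe #-}

-- One customer of capacity 1: a query of value 1 arrives for certain, and later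
-- a query of value 1/ε arrives with probability ε. Online, serving either one
-- is worth 1 in expectation, and only one of them can be served; with hindsight
-- the second is served when it arrives and the first otherwise, which is worth
-- 1 + (1 - ε).
module Submission where

open import Defs
open import Data.Bool using (Bool; true; false; if_then_else_; not; _∧_)
import Data.Bool.Properties as Bool
open import Data.Empty using (⊥-elim)
open import Data.Fin using (Fin; suc; toℕ)
open import Data.Fin.Patterns using (0F; 1F)
open import Data.Fin.Properties using (toℕ-injective)
open import Data.Nat using (ℕ; z≤n; s≤s)
import Data.Nat as ℕ
open import Data.Product using (Σ-syntax; ∃-syntax; _×_; _,_; proj₁; proj₂)
open import Data.Sum using (inj₁; inj₂)
open import Data.Vec using ([]; _∷_; lookup)
open import Level using (Level)
open import Relation.Binary using (IsTotalOrder; Poset)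
open import Relation.Binary.PropositionalEquality using (subst)
import Relation.Binary.PropositionalEquality as ≡
open import Relation.Nullary using (¬_; does)

-- Arithmetic in an ordered field.

module OrderedFieldProperties {c ℓ₁ ℓ₂ : Level} (F : OrderedField c ℓ₁ ℓ₂) where
  open OrderedField F
  open AdCell F using (sumF)
  open import Algebra.Properties.Ring ring using (-‿distribˡ-*; -‿distribʳ-*; -‿involutive)

  open IsTotalOrder isTotalOrder public
    using (total; antisym; isPartialOrder; ≤-respʳ-≈; ≤-respˡ-≈)
    renaming (refl to ≤-refl; reflexive to ≤-reflexive; trans to ≤-trans)

  ≤-poset : Poset c ℓ₁ ℓ₂
  ≤-poset = record { isPartialOrder = isPartialOrder }

  open import Relation.Binary.Reasoning.PartialOrder ≤-poset public
    using (begin_; step-≤; step-≈-⟩; step-≈-⟨; _∎)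

  +-mono-≤ : ∀ {x y z w} → x ≤ y → z ≤ w → x + z ≤ y + w
  +-mono-≤ {x} {y} {z} {w} x≤y z≤w = begin
    x + z ≤⟨ +-monoʳ-≤ x z≤w ⟩
    x + w ≈⟨ +-comm x w ⟩
    w + x ≤⟨ +-monoʳ-≤ w x≤y ⟩
    w + y ≈⟨ +-comm w y ⟩
    y + w ∎

  +-nonneg : ∀ {x y} → 0# ≤ x → 0# ≤ y → 0# ≤ x + y
  +-nonneg 0≤x 0≤y = ≤-respˡ-≈ (+-identityʳ 0#) (+-mono-≤ 0≤x 0≤y)

  x≤x+y : ∀ x {y} → 0# ≤ y → x ≤ x + y
  x≤x+y x 0≤y = ≤-respˡ-≈ (+-identityʳ x) (+-monoʳ-≤ x 0≤y)

  x+[y-x]≈y : ∀ x y → x + (y - x) ≈ y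
  x+[y-x]≈y x y = trans (+-congˡ (+-comm y (- x)))
    (trans (sym (+-assoc x (- x) y))
      (trans (+-congʳ (-‿inverseʳ x)) (+-identityˡ y)))

  x≤y⇒0≤y-x : ∀ {x y} → x ≤ y → 0# ≤ y - x
  x≤y⇒0≤y-x {x} {y} x≤y = begin
    0#        ≈⟨ -‿inverseˡ x ⟨
    - x + x   ≤⟨ +-monoʳ-≤ (- x) x≤y ⟩
    - x + y   ≈⟨ +-comm (- x) y ⟩
    y - x     ∎

  *-monoˡ-≤ : ∀ {x y z} → 0# ≤ z → x ≤ y → z * x ≤ z * y
  *-monoˡ-≤ {x} {y} {z} 0≤z x≤y = begin
    z * x                 ≤⟨ x≤x+y (z * x) (*-nonneg 0≤z (x≤y⇒0≤y-x x≤y)) ⟩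
    z * x + z * (y - x)   ≈⟨ distribˡ z x (y - x) ⟨
    z * (x + (y - x))     ≈⟨ *-congˡ (x+[y-x]≈y x y) ⟩
    z * y                 ∎

  square-nonneg : ∀ x → 0# ≤ x * x
  square-nonneg x with total 0# x
  ... | inj₁ 0≤x = *-nonneg 0≤x 0≤x
  ... | inj₂ x≤0 = ≤-respʳ-≈ -x*-x≈x*x (*-nonneg 0≤-x 0≤-x)
    where
      0≤-x : 0# ≤ - x
      0≤-x = ≤-respʳ-≈ (+-identityˡ (- x)) (x≤y⇒0≤y-x x≤0)
      -x*-x≈x*x : - x * - x ≈ x * x
      -x*-x≈x*x = trans (sym (-‿distribˡ-* x (- x)))
        (trans (-‿cong (sym (-‿distribʳ-* x x))) (-‿involutive (x * x)))

  0≤1 : 0# ≤ 1#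
  0≤1 = ≤-respʳ-≈ (*-identityˡ 1#) (square-nonneg 1#)

  -- The inverse `y` equals `x * (y * y)`, a product of a nonnegative element and a square.
  inv-nonneg : ∀ {x} → 0# ≤ x → (x≉0 : ¬ x ≈ 0#) → 0# ≤ inv x x≉0
  inv-nonneg {x} 0≤x x≉0 = ≤-respʳ-≈ x*y²≈y (*-nonneg 0≤x (square-nonneg y))
    where
      y = inv x x≉0
      x*y²≈y : x * (y * y) ≈ y
      x*y²≈y = trans (sym (*-assoc x y y))
        (trans (*-congʳ (inv-inverse x x≉0)) (*-identityˡ y))

  ½-nonneg : 0# ≤ ½
  ½-nonneg = inv-nonneg (+-nonneg 0≤1 0≤1) 2≉0

  ½≤1 : ½ ≤ 1#
  ½≤1 = begin
    ½                  ≤⟨ x≤x+y ½ ½-nonneg ⟩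
    ½ + ½              ≈⟨ +-cong (*-identityˡ ½) (*-identityˡ ½) ⟨
    1# * ½ + 1# * ½    ≈⟨ distribʳ ½ 1# 1# ⟨
    (1# + 1#) * ½      ≈⟨ inv-inverse (1# + 1#) 2≉0 ⟩
    1#                 ∎

  sum-mono-≤ : ∀ {n} (f g : Fin n → Carrier) → (∀ r → f r ≤ g r) → sumF f ≤ sumF g
  sum-mono-≤ {ℕ.zero}  f g f≤g = ≤-refl
  sum-mono-≤ {ℕ.suc n} f g f≤g =
    +-mono-≤ (f≤g 0F) (sum-mono-≤ (λ r → f (suc r)) (λ r → g (suc r)) (λ r → f≤g (suc r)))

  -- The witness is the minimum of `δ` and `1#`: it has to serve as a probability in the instance
  -- and as a lower bound for the slack `δ` in the ratio.
  ∃-positive-≤1 : ∀ δ → 0# < δ → ∃[ ε ] (0# < ε × ε ≤ 1# × ε ≤ δ)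
  ∃-positive-≤1 δ 0<δ with total δ 1#
  ... | inj₁ δ≤1 = δ , 0<δ , δ≤1 , ≤-refl
  ... | inj₂ 1≤δ = 1# , (0≤1 , 0≉1) , ≤-refl , 1≤δ

-- The two-query instance.

module HardInstance {c ℓ₁ ℓ₂ : Level} (F : OrderedField c ℓ₁ ℓ₂)
  (ε : OrderedField.Carrier F)
  (0<ε : OrderedField._<_ F (OrderedField.0# F) ε)
  (ε≤1 : OrderedField._≤_ F ε (OrderedField.1# F)) where

  open OrderedField F
  open AdCell F
  open OrderedFieldProperties F
  open import Algebra.Solver.Ring.NaturalCoefficients.Default commutativeSemiring
    using (solve; _:=_; _:+_; _:*_; con)

  ε≉0 : ¬ ε ≈ 0#
  ε≉0 ε≈0 = proj₂ 0<ε (sym ε≈0)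

  η K : Carrier
  η = 1# - ε
  K = inv ε ε≉0

  0≤ε : 0# ≤ ε
  0≤ε = proj₁ 0<ε

  0≤η : 0# ≤ η
  0≤η = x≤y⇒0≤y-x ε≤1

  ε+η≈1 : ε + η ≈ 1#
  ε+η≈1 = x+[y-x]≈y ε 1#

  εK≈1 : ε * K ≈ 1#
  εK≈1 = inv-inverse ε ε≉0

  0≤K : 0# ≤ K
  0≤K = inv-nonneg 0≤ε ε≉0

  -- This makes the uncertain query the better one to serve whenever it arrives.
  1≤K : 1# ≤ K
  1≤K = begin
    1#      ≈⟨ εK≈1 ⟨
    ε * K   ≈⟨ *-comm ε K ⟩
    K * ε   ≤⟨ *-monoˡ-≤ 0≤K ε≤1 ⟩
    K * 1#  ≈⟨ *-identityʳ K ⟩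
    K       ∎

  -- The distributions of the two arrival indicators; their product is the joint law, so
  -- independence is built in.
  first second : Bool → Carrier
  first  b = if b then 1# else 0#
  second b = if b then ε else η

  hardLaw : Outcome 2 → Carrier
  hardLaw (x ∷ y ∷ []) = first x * second y

  hardLaw-nonneg : ∀ ω → 0# ≤ hardLaw ω
  hardLaw-nonneg (x ∷ y ∷ []) = *-nonneg (first-nonneg x) (second-nonneg y)
    where
      first-nonneg : ∀ b → 0# ≤ first b
      first-nonneg true  = 0≤1
      first-nonneg false = ≤-refl
      second-nonneg : ∀ b → 0# ≤ second b
      second-nonneg true  = 0≤ε
      second-nonneg false = 0≤η

  -- For a concrete `b` this computes to the same four-term sum as the instance's `Pr` of the
  -- corresponding event, so the lemmas on it fit the `marginal` and `independent` fields directly.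
  Pr-lookup : Fin 2 → Bool → Carrier
  Pr-lookup j b =
    sumOutcomes (λ ω → if does (lookup ω j Bool.≟ b) then hardLaw ω else 0#)

  Pr-first : ∀ b → Pr-lookup 0F b ≈ first b
  Pr-first true = trans
    (solve 2 (λ e h → (con 1 :* e :+ con 1 :* h) :+ (con 0 :+ con 0) := e :+ h) refl ε η)
    ε+η≈1
  Pr-first false =
    solve 2 (λ e h → (con 0 :+ con 0) :+ (con 0 :* e :+ con 0 :* h) := con 0) refl ε η

  Pr-second : ∀ b → Pr-lookup 1F b ≈ second b
  Pr-second true =
    solve 1 (λ e → (con 1 :* e :+ con 0) :+ (con 0 :* e :+ con 0) := e) refl ε
  Pr-second false =
    solve 1 (λ h → (con 0 :+ con 1 :* h) :+ (con 0 :+ con 0 :* h) := h) refl η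

  first*second : ∀ x y → first x * second y ≈ Pr-lookup 0F x * Pr-lookup 1F y
  first*second x y = *-cong (sym (Pr-first x)) (sym (Pr-second y))

  second*first : ∀ x y → first x * second y ≈ Pr-lookup 1F y * Pr-lookup 0F x
  second*first x y = trans (first*second x y) (*-comm _ _)

  hard : Instance
  hard = record
    { m = 1 ; n = 2 ; s = 1
    ; u           = λ { _ 0F → 1# ; _ 1F → K }
    ; u-nonneg    = λ { _ 0F → 0≤1 ; _ 1F → 0≤K }
    ; customer    = λ _ → 0F
    ; capacity    = λ _ → 1
    ; time        = toℕ
    ; p           = λ { 0F → 1# ; 1F → ε }
    ; law         = hardLaw
    ; law-nonneg  = hardLaw-nonneg
    ; law-total   = trans
        (solve 2 (λ e h → (con 1 :* e :+ con 1 :* h) :+ (con 0 :* e :+ con 0 :* h) := e :+ h)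
          refl ε η)
        ε+η≈1
    ; marginal    = λ { 0F → Pr-first true ; 1F → Pr-second true }
    -- Arrival times are distinct, so no two queries share a slot.
    ; exclusive   = λ j≢j′ slot _ _ _ → ⊥-elim (j≢j′ (toℕ-injective (proj₂ slot)))
    -- Each slot is a single query. Splitting on the outcome lets the agreement tests compute, which
    -- turns both factors into instances of `Pr-lookup`.
    ; independent = λ
        { 0F (true  ∷ true  ∷ []) → first*second true true
        ; 0F (true  ∷ false ∷ []) → first*second true false
        ; 0F (false ∷ true  ∷ []) → first*second false true
        ; 0F (false ∷ false ∷ []) → first*second false false
        ; 1F (true  ∷ true  ∷ []) → second*first true true
        ; 1F (true  ∷ false ∷ []) → second*first true false
        ; 1F (false ∷ true  ∷ []) → second*first false true
        ; 1F (false ∷ false ∷ []) → second*first false false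
        }
    }

  -- Payoffs and the offline optimum.

  served : Bool → ℕ
  served b = bit hard b ℕ.+ 0

  -- The trailing zeros come from unfolding `sumℕ` over one advertiser and two queries, so the
  -- fields of `Feasible` have these types by computation.
  Within : Bool → Bool → Set
  Within a b = served a ℕ.+ (served b ℕ.+ 0) ℕ.≤ 1

  payoff : Bool → Bool → Carrier
  payoff a b = (if a then 1# else 0#) + (if b then K else 0#)

  payoff-nonneg : ∀ a b → 0# ≤ payoff a b
  payoff-nonneg true  true  = +-nonneg 0≤1 0≤K
  payoff-nonneg true  false = +-nonneg 0≤1 ≤-refl
  payoff-nonneg false true  = +-nonneg ≤-refl 0≤K
  payoff-nonneg false false = +-nonneg ≤-refl ≤-refl

  revenue≈payoff : ∀ X → revenue hard X ≈ payoff (X 0F 0F) (X 0F 1F)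
  revenue≈payoff X = solve 2 (λ a b → (a :+ (b :+ con 0)) :+ con 0 := a :+ b) refl _ _

  -- The first query is certain to arrive, so the two outcomes without it have weight zero.
  𝔼≈ : ∀ f → Instance.𝔼 hard f ≈ ε * f (true ∷ true ∷ []) + η * f (true ∷ false ∷ [])
  𝔼≈ f = solve 6
    (λ e h a b c d →
      ((con 1 :* e) :* a :+ (con 1 :* h) :* b) :+ ((con 0 :* e) :* c :+ (con 0 :* h) :* d)
        := e :* a :+ h :* b)
    refl ε η _ _ _ _

  -- Capacity rules out serving both queries and arrival rules out serving an absent one. The only
  -- real comparison left is between `1#` and `K` when both arrive, settled by `1≤K`.
  payoff-optimal : ∀ x y a b →
    served a ℕ.≤ bit hard x → served b ℕ.≤ bit hard y → Within a b →
    payoff a b ≤ payoff (not y ∧ x) y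
  payoff-optimal x     y     true  true  _  _  (s≤s ())
  payoff-optimal true  true  true  false _  _  _ = begin
    1# + 0#  ≈⟨ +-comm 1# 0# ⟩
    0# + 1#  ≤⟨ +-monoʳ-≤ 0# 1≤K ⟩
    0# + K   ∎
  payoff-optimal true  false true  false _  _  _ = ≤-refl
  payoff-optimal false y     true  false () _  _
  payoff-optimal x     true  false true  _  _  _ = ≤-refl
  payoff-optimal x     false false true  _  () _
  payoff-optimal x     y     false false _  _  _ =
    ≤-respˡ-≈ (sym (+-identityʳ 0#)) (payoff-nonneg (not y ∧ x) y)

  OPT : OptimalOffline hard
  OPT = record
    { alloc    = greedy
    ; feasible = λ { (x ∷ y ∷ []) → greedy-feasible x y }
    ; optimal  = λ { (x ∷ y ∷ []) X fX → greedy-optimal x y X fX }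
    }
    where
      greedy : Outcome 2 → Allocation hard
      greedy (x ∷ y ∷ []) _ 0F = not y ∧ x
      greedy (x ∷ y ∷ []) _ 1F = y

      greedy-feasible : ∀ x y → Feasible hard (x ∷ y ∷ []) (greedy (x ∷ y ∷ []))
      greedy-feasible true true = record
        { arrived = λ { 0F → z≤n ; 1F → s≤s z≤n } ; within = λ { 0F → s≤s z≤n } }
      greedy-feasible true false = record
        { arrived = λ { 0F → s≤s z≤n ; 1F → z≤n } ; within = λ { 0F → s≤s z≤n } }
      greedy-feasible false true = record
        { arrived = λ { 0F → z≤n ; 1F → s≤s z≤n } ; within = λ { 0F → s≤s z≤n } }
      greedy-feasible false false = record
        { arrived = λ { 0F → z≤n ; 1F → z≤n } ; within = λ { 0F → z≤n } }

      greedy-optimal : ∀ x y X → Feasible hard (x ∷ y ∷ []) X →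
        revenue hard X ≤ revenue hard (greedy (x ∷ y ∷ []))
      greedy-optimal x y X fX = begin
        revenue hard X                         ≈⟨ revenue≈payoff X ⟩
        payoff (X 0F 0F) (X 0F 1F)             ≤⟨ payoff-optimal x y _ _
                                                    (arrived 0F) (arrived 1F) (within 0F) ⟩
        payoff (not y ∧ x) y                   ≈⟨ revenue≈payoff (greedy (x ∷ y ∷ [])) ⟨
        revenue hard (greedy (x ∷ y ∷ []))     ∎
        where open Feasible fX

  -- The optimum earns `K` with probability `ε` and `1#` with probability `η`, and `ε * K` is `1#`.
  offlineRevenue≈1+η : offlineRevenue hard OPT ≈ 1# + η
  offlineRevenue≈1+η = trans (𝔼≈ (λ ω → revenue hard (OptimalOffline.alloc OPT ω)))
    (trans
      (solve 3 (λ e h k → e :* ((con 0 :+ (k :+ con 0)) :+ con 0)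
                          :+ h :* ((con 1 :+ (con 0 :+ con 0)) :+ con 0)
                        := e :* k :+ h) refl ε η K)
      (+-congʳ εK≈1))

  -- The bound on online algorithms.

  committed-payoff≤1 : ∀ a b b′ → Within a b → served b′ ℕ.≤ 0 →
    ε * payoff a b + η * payoff a b′ ≤ 1#
  committed-payoff≤1 a     b     true  _        ()
  committed-payoff≤1 true  true  false (s≤s ()) _
  -- Serving the first query exhausts the capacity and earns `1#` in both outcomes.
  committed-payoff≤1 true  false false _ _ = ≤-reflexive (trans
    (solve 2 (λ e h → e :* (con 1 :+ con 0) :+ h :* (con 1 :+ con 0) := e :+ h) refl ε η)
    ε+η≈1)
  -- Waiting earns `K`, but only with probability `ε`.
  committed-payoff≤1 false true  false _ _ = ≤-reflexive (trans
    (solve 3 (λ e h k → e :* (con 0 :+ k) :+ h :* (con 0 :+ con 0) := e :* k) refl ε η K)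
    εK≈1)
  committed-payoff≤1 false false false _ _ = ≤-respˡ-≈
    (solve 2 (λ e h → con 0 := e :* (con 0 :+ con 0) :+ h :* (con 0 :+ con 0)) refl ε η)
    0≤1

  deterministic≤1 : (D : DeterministicOnline hard) →
    Instance.𝔼 hard (λ ω → revenue hard (DeterministicOnline.alloc D ω)) ≤ 1#
  deterministic≤1 D = begin
    Instance.𝔼 hard (λ ω → revenue hard (alloc ω))
      ≈⟨ 𝔼≈ (λ ω → revenue hard (alloc ω)) ⟩
    ε * revenue hard (alloc both) + η * revenue hard (alloc one)
      ≈⟨ +-cong (*-congˡ (revenue≈payoff (alloc both))) (*-congˡ (revenue≈payoff (alloc one))) ⟩
    ε * payoff a b + η * payoff (alloc one 0F 0F) b′
      ≤⟨ subst (λ a′ → ε * payoff a b + η * payoff a′ b′ ≤ 1#)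
           -- The choice on the first query is made before the two outcomes differ, so a single `a`
           -- describes it in both.
           (nonanticipating 0F both one agree 0F)
           (committed-payoff≤1 a b b′
             (Feasible.within (feasible both) 0F) (Feasible.arrived (feasible one) 1F)) ⟩
    1# ∎
    where
      open DeterministicOnline D
      both one : Outcome 2
      both = true ∷ true ∷ []
      one  = true ∷ false ∷ []
      a b b′ : Bool
      a  = alloc both 0F 0F
      b  = alloc both 0F 1F
      b′ = alloc one 0F 1F
      agree : AgreeOn (λ j → toℕ j ℕ.≤ 0) both one
      -- Only the first query has arrival time at most `0`; the case of the second is absurd.
      agree 0F _ = ≡.refl

  -- A randomized algorithm earns a convex combination of deterministic revenues, each at most `1#`.
  onlineRevenue≤1 : (A : OnlineAlgorithm hard) → onlineRevenue hard A ≤ 1#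
  onlineRevenue≤1 A = ≤-respʳ-≈ weight-total
    (sum-mono-≤ _ weight
      (λ r → ≤-respʳ-≈ (*-identityʳ (weight r))
        (*-monoˡ-≤ (weight-nonneg r) (deterministic≤1 (run r)))))
    where open OnlineAlgorithm A

  -- Comparison of the online bound with the offline revenue.

  1≤1+η : 1# ≤ 1# + η
  1≤1+η = x≤x+y 1# 0≤η

  0<offlineRevenue : 0# < offlineRevenue hard OPT
  0<offlineRevenue =
    ≤-respʳ-≈ (sym offlineRevenue≈1+η) (≤-trans 0≤1 1≤1+η) ,
    -- A zero offline revenue would give `1# ≤ 0#`, since it is at least `1#`.
    λ 0≈OPT → 0≉1 (antisym 0≤1
      (≤-respʳ-≈ (trans (sym offlineRevenue≈1+η) (sym 0≈OPT)) 1≤1+η))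

  -- Writing two as `1# + (ε + η)` and halving gives `½ * (1# + η)` plus a remainder `ε * ½`, and
  -- the remainder is at most `ε * (1# + η)`.
  1≤[½+ε][1+η] : 1# ≤ (½ + ε) * (1# + η)
  1≤[½+ε][1+η] = begin
    1#                                  ≈⟨ inv-inverse (1# + 1#) 2≉0 ⟨
    (1# + 1#) * ½                       ≈⟨ *-congʳ (+-congˡ ε+η≈1) ⟨
    (1# + (ε + η)) * ½                  ≈⟨ solve 3 (λ e h t → (con 1 :+ (e :+ h)) :* t
                                             := t :* (con 1 :+ h) :+ e :* t) refl ε η ½ ⟩
    ½ * (1# + η) + ε * ½                ≤⟨ +-monoʳ-≤ _ (*-monoˡ-≤ 0≤ε ½≤1+η) ⟩
    ½ * (1# + η) + ε * (1# + η)         ≈⟨ distribʳ (1# + η) ½ ε ⟨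
    (½ + ε) * (1# + η)                  ∎
    where
      ½≤1+η : ½ ≤ 1# + η
      ½≤1+η = ≤-trans ½≤1 1≤1+η

  1≤[½+δ]*offlineRevenue : ∀ {δ} → ε ≤ δ → 1# ≤ (½ + δ) * offlineRevenue hard OPT
  1≤[½+δ]*offlineRevenue {δ} ε≤δ = begin
    1#                                ≤⟨ 1≤[½+ε][1+η] ⟩
    (½ + ε) * (1# + η)                ≈⟨ *-comm _ _ ⟩
    (1# + η) * (½ + ε)                ≤⟨ *-monoˡ-≤ (≤-trans 0≤1 1≤1+η) (+-monoʳ-≤ ½ ε≤δ) ⟩
    (1# + η) * (½ + δ)                ≈⟨ *-comm _ _ ⟩
    (½ + δ) * (1# + η)                ≈⟨ *-congˡ offlineRevenue≈1+η ⟨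
    (½ + δ) * offlineRevenue hard OPT ∎

mainTheorem6 : {c ℓ₁ ℓ₂ : Level} (F : OrderedField c ℓ₁ ℓ₂) →
    let open OrderedField F
        open AdCell F
    in
    (δ : Carrier) → 0# < δ →
    Σ[ I ∈ Instance ] Σ[ OPT ∈ OptimalOffline I ]
      (0# < offlineRevenue I OPT ×
       ((A : OnlineAlgorithm I) →
         onlineRevenue I A ≤ (½ + δ) * offlineRevenue I OPT))
mainTheorem6 F δ 0<δ with OrderedFieldProperties.∃-positive-≤1 F δ 0<δ
... | ε , 0<ε , ε≤1 , ε≤δ =
  hard , OPT , 0<offlineRevenue ,
  λ A → ≤-trans (onlineRevenue≤1 A) (1≤[½+δ]*offlineRevenue ε≤δ)
  where
    open OrderedFieldProperties F using (≤-trans)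
    open HardInstance F ε 0<ε ε≤1
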